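{- For every positive integer $n\neq 11$, \[K(n)=\left\lfloor \frac n6\right\rfloor+\left\lfloor\frac{n+4}6\right\rfloor+1,\] and $K(11)=5$.
   Context: Words are finite strings over the two-letter alphabet $\{a,b\}$; concatenation is the product of words. The length of a word $w$ is $l(w)$. A word $w=a_0\dots a_n$ is a palindrome (symmetric) if $a_i=a_{n-i}$ for all $i\le n$. For a nonempty word $w$, $m(w)$ denotes the minimal number $k$ such that $w=p_1p_2\cdots p_k$ with $p_1,\dots,p_k$ nonempty palindromes. For a positive integer $n$, $K(n)=\max\{m(w): w \text{ a binary word with } l(w)=n\}$. -}

module Defs where

open import Data.Nat using (ℕ; zero; suc; _≤_)
open import Data.List using (List; []; _∷_; _++_; reverse; length)
open import Data.Product using (Σ; _×_; ∃-syntax)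
open import Relation.Binary.PropositionalEquality using (_≡_)

data Letter : Set where
  a b : Letter

Word : Set
Word = List Letter

Palindrome : Word → Set
Palindrome w = reverse w ≡ w

NonEmpty : Word → Set
NonEmpty w = ∃[ x ] ∃[ v ] (w ≡ x ∷ v)

data PalFact : ℕ → Word → Set where
  pf-nil  : PalFact zero []
  pf-cons : ∀ {k} p w → NonEmpty p → Palindrome p → PalFact k w → PalFact (suc k) (p ++ w)

IsM : Word → ℕ → Set
IsM w k = PalFact k w × (∀ j → PalFact j w → k ≤ j)

IsK : ℕ → ℕ → Set
IsK n K = (∃[ w ] (length w ≡ n × IsM w K))
        × (∀ w k → length w ≡ n → IsM w k → k ≤ K)

{-# OPTIONS --safe #-}
module Submission where

-- Upper bound: read the word from left to right, keeping for the last few cut positions the number of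
-- palindromes used so far.  A bounded case analysis on the first letters finds a prefix that can be cut
-- off by the induction hypothesis, except along the word aababbb(aababb)(aababb)..., where the induction
-- is closed by proving simultaneously a bound for the state reached there.  The formula grows by 2 when
-- n grows by 6, so the case analyses for finitely many lengths settle all lengths.
--
-- Lower bound: in aababbb(aababb)^k aaababb all palindromes have length at most 5, so the minimal numbers
-- of palindromes for its suffixes obey a local recursion that is periodic in k; the six longest suffixes
-- realise the six residue classes of n modulo 6.

open import Defs
open import Data.Bool as Bool using (if_then_else_; true; false)
open import Data.Fin using (Fin; toℕ)
open import Data.Fin.Patterns
open import Data.List using (List; []; _∷_; _++_; _∷ʳ_; length; reverse; map; filter; take; drop; initLast; _∷ʳ′_)
open import Data.List.Extrema.Nat using (min; argmin-sel; min≤v⁺)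
open import Data.List.Membership.Propositional using (_∈_; find; lose)
open import Data.List.Membership.Propositional.Properties using (∈-map⁻; ∈-filter⁻)
open import Data.List.Properties using (≡-dec; ++-assoc; ++-identityʳ; length-++; length-++-≤ˡ; reverse-++; unfold-reverse; ∷-injective; ∷-injectiveʳ; ∷ʳ-injectiveˡ)
open import Data.List.Relation.Unary.All as All using (All; []; _∷_)
open import Data.List.Relation.Unary.Any as Any using (Any; here; there)
open import Data.Nat using (ℕ; zero; suc; _+_; _*_; _∸_; _/_; _%_; _≡ᵇ_; _≤_; _<_; z≤n; s≤s; _≤?_; _<?_)
open import Data.Nat.Divisibility using (divides)
open import Data.Nat.DivMod using (+-distrib-/-∣ˡ; _divMod_; result)
open import Data.Nat.Induction using (<-rec)
open import Data.Nat.Properties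
open import Data.Product as Product using (_×_; _,_; ∃-syntax; proj₁; proj₂; uncurry)
open import Data.Sum using (inj₁; inj₂; [_,_])
open import Data.Unit using (⊤; tt)
open import Function using (_∘_; id)
open import Relation.Binary.Definitions using (DecidableEquality)
open import Relation.Binary.PropositionalEquality using (_≡_; _≢_; refl; sym; trans; cong; cong₂; subst; subst₂; module ≡-Reasoning)
open import Relation.Nullary using (¬_; Dec; yes; no; does; ¬?; contradiction)
open import Relation.Nullary.Decidable using (_×-dec_; _⊎-dec_; _→-dec_; map′; from-yes)
open import Relation.Unary using (Decidable)

-- Decidability and the arithmetic of the formula.

_≟ᴸ_ : DecidableEquality Letter
a ≟ᴸ a = yes refl
a ≟ᴸ b = no λ ()
b ≟ᴸ a = no λ ()
b ≟ᴸ b = yes refl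

_≟ᵂ_ : DecidableEquality Word
_≟ᵂ_ = ≡-dec _≟ᴸ_

palindrome? : Decidable Palindrome
palindrome? w = reverse w ≟ᵂ w

formula : ℕ → ℕ
formula n = n / 6 + (n + 4) / 6 + 1

formula-+6 : ∀ n → formula (6 + n) ≡ 2 + formula n
formula-+6 n = begin
  (6 + n) / 6 + (6 + (n + 4)) / 6 + 1     ≡⟨ cong₂ (λ x y → x + y + 1) (6+/6 n) (6+/6 (n + 4)) ⟩
  suc (n / 6) + suc ((n + 4) / 6) + 1     ≡⟨ cong (λ x → suc x + 1) (+-suc (n / 6) ((n + 4) / 6)) ⟩
  2 + formula n                           ∎
  where
  open ≡-Reasoning
  6+/6 : ∀ m → (6 + m) / 6 ≡ suc (m / 6)
  6+/6 m = +-distrib-/-∣ˡ {6} m (divides 1 refl)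

-- The value 0 at 0 is the true one, whereas 'formula 0' is 1.
maxPals : ℕ → ℕ
maxPals zero    = 0
maxPals (suc n) = if n ≡ᵇ 10 then 5 else formula (suc n)

-- Upper bound: states and reading one letter.

-- A state describes a word read so far: an entry (s , c) says that this word is y ++ s for some y that
-- is a product of c palindromes.
State : Set
State = List (Word × ℕ)

Cheap : ℕ → Word → Word × ℕ → Set
Cheap T v (s , c) = ∃[ j ] PalFact j (s ++ v) × c + j ≤ T

Good : ℕ → State → Word → Set
Good T S v = Any (Cheap T v) S

-- Pending words are cut off at length 7: palindromes of length at most 8 suffice.
extend : Letter → State → State
extend x = map (λ (s , c) → s ∷ʳ x , c) ∘ filter (λ (s , _) → length s <? 7)

cutCosts : Letter → State → List ℕ
cutCosts x = map (suc ∘ proj₂) ∘ filter (λ (s , _) → palindrome? (s ∷ʳ x))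

cheapest : List ℕ → State
cheapest []       = []
cheapest (c ∷ cs) = ([] , min c cs) ∷ []

read : Letter → State → State
read x S = cheapest (cutCosts x S) ++ extend x S

∷ʳ-nonEmpty : ∀ s x → NonEmpty (s ∷ʳ x)
∷ʳ-nonEmpty []      x = x , [] , refl
∷ʳ-nonEmpty (y ∷ s) x = y , s ∷ʳ x , refl

cutCosts-sound : ∀ {T v c} x S → c ∈ cutCosts x S → Cheap T v ([] , c) → Good T S (x ∷ v)
cutCosts-sound {T} {v} x S c∈ (j , fact , c+j≤T)
  with (s , c) , sc∈ , refl ← ∈-map⁻ (suc ∘ proj₂) c∈
  with sc∈S , pal ← ∈-filter⁻ (λ (s , _) → palindrome? (s ∷ʳ x)) {xs = S} sc∈
  = lose sc∈S (suc j
             , subst (PalFact _) (++-assoc s _ v) (pf-cons _ v (∷ʳ-nonEmpty s x) pal fact)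
             , subst (_≤ T) (sym (+-suc c j)) c+j≤T)

extend-sound : ∀ {T v} x S → Good T (extend x S) v → Good T S (x ∷ v)
extend-sound {v = v} x S good
  with _ , e∈ , (j , fact , le) ← find good
  with (s , c) , sc∈ , refl ← ∈-map⁻ (λ (s , c) → s ∷ʳ x , c) e∈
  = lose (proj₁ (∈-filter⁻ (λ (s , _) → length s <? 7) {xs = S} sc∈)) (j , subst (PalFact j) (++-assoc s _ v) fact , le)

-- Every entry of `read x S` arises from an entry of `S` by lengthening its pending word or closing
-- it as a palindrome; entries that `read` drops therefore do no harm.
read-sound : ∀ {T v} x S → Good T (read x S) v → Good T S (x ∷ v)
read-sound x S = go (cutCosts x S) id
  where
  go : ∀ {T v} cs → (∀ {c} → c ∈ cs → c ∈ cutCosts x S) →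
       Good T (cheapest cs ++ extend x S) v → Good T S (x ∷ v)
  go []       sub good         = extend-sound x S good
  go (c ∷ cs) sub (there good) = extend-sound x S good
  go (c ∷ cs) sub (here cheap) with argmin-sel id c cs
  ... | inj₁ eq  = cutCosts-sound x S (sub (here eq)) cheap
  ... | inj₂ min∈ = cutCosts-sound x S (sub (there min∈)) cheap

start : State
start = ([] , 0) ∷ []

-- Upper bound: the finite search.

-- The state (minus irrelevant entries, and up to a common cost) reached after reading
-- aababbb·aababb·aa; reading one more period babbaa leads back to it at the cost of two palindromes.
loopᵃ loopᵇ : State
loopᵃ = (b ∷ b ∷ a ∷ a ∷ [] , 0) ∷ (b ∷ a ∷ a ∷ [] , 1) ∷ (a ∷ a ∷ [] , 1) ∷ (a ∷ [] , 1) ∷ []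
loopᵇ = (a ∷ a ∷ b ∷ b ∷ [] , 0) ∷ (a ∷ b ∷ b ∷ [] , 1) ∷ (b ∷ b ∷ [] , 1) ∷ (b ∷ [] , 1) ∷ []

-- The loop is first met after 15 letters, so 2 modulo 6 letters remain just when the total length
-- is 5 modulo 6, the last residue before `formula` increases.
states : ℕ → List State
states n = start ∷ (if n % 6 ≡ᵇ 2 then loopᵃ ∷ loopᵇ ∷ [] else [])

-- S does at least as well as H, provided that H meets the bound 'maxPals r' on words of length r.
Covers : ℕ → ℕ → State → State → Set
Covers r T S H = All (λ (s′ , c′) → Any (λ (s , c) → s ≡ s′ × c + maxPals r ≤ c′ + T) S) H

Closes : ℕ → ℕ → State → Set
Closes r T S = Any (Covers r T S) (states r)

-- Among the next 'fuel' of the r letters still to come, S always reaches a state of the list.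
data Check : (fuel r T : ℕ) → State → Set where
  close  : ∀ {fuel r T S} → Closes r T S → Check fuel r T S
  branch : ∀ {fuel r T S} → Check fuel r T (read a S) → Check fuel r T (read b S) →
           Check (suc fuel) (suc r) T S

closes? : ∀ r T S → Dec (Closes r T S)
closes? r T S = Any.any? (All.all? λ (s′ , c′) → Any.any? (λ (s , c) →
  (s ≟ᵂ s′) ×-dec (c + maxPals r ≤? c′ + T)) S) (states r)

check? : ∀ fuel r T S → Dec (Check fuel r T S)
check? zero       r       T S = map′ close (λ where (close p) → p) (closes? r T S)
check? (suc fuel) zero    T S = map′ close (λ where (close p) → p) (closes? zero T S)
check? (suc fuel) (suc r) T S =
  map′ [ close , uncurry branch ] (λ where
    (close p)    → inj₁ p
    (branch p q) → inj₂ (p , q))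
    (closes? (suc r) T S ⊎-dec (check? fuel r T (read a S) ×-dec check? fuel r T (read b S)))

-- One letter is read before the search starts; otherwise `H` would close at once against itself.
Certificate : (fuel r : ℕ) → Set
Certificate fuel r = All (λ H → Check fuel r (maxPals (suc r)) (read a H)
                              × Check fuel r (maxPals (suc r)) (read b H)) (states (suc r))

certificate? : ∀ fuel r → Dec (Certificate fuel r)
certificate? fuel r = All.all? (λ H → check? fuel r (maxPals (suc r)) (read a H)
                                ×-dec check? fuel r (maxPals (suc r)) (read b H)) (states (suc r))

Valid : ℕ → Set
Valid r = All (λ H → ∀ v → length v ≡ r → Good (maxPals r) H v) (states r)

closes-sound : ∀ {r T} S → Valid r → Closes r T S → ∀ v → length v ≡ r → Good T S v
closes-sound {r} {T} S valid closes v |v|≡r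
  with H , H∈ , covers ← find closes
  with (s , c′) , sc∈ , (j , fact , c′+j≤) ← find (All.lookup valid H∈ v |v|≡r)
  = Any.map transfer (All.lookup covers sc∈)
  where
  open ≤-Reasoning
  transfer : ∀ {e} → proj₁ e ≡ s × proj₂ e + maxPals r ≤ c′ + T → Cheap T v e
  transfer {_ , c} (refl , le) = j , fact , +-cancelˡ-≤ c′ (c + j) T (begin
    c′ + (c + j)    ≡⟨ +-assoc c′ c j ⟨
    c′ + c + j      ≡⟨ cong (_+ j) (+-comm c′ c) ⟩
    c + c′ + j      ≡⟨ +-assoc c c′ j ⟩
    c + (c′ + j)    ≤⟨ +-monoʳ-≤ c c′+j≤ ⟩
    c + maxPals r   ≤⟨ le ⟩
    c′ + T          ∎)

check-sound : ∀ {fuel r T} S → (∀ {r′} → r′ ≤ r → Valid r′) → Check fuel r T S →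
              ∀ v → length v ≡ r → Good T S v
check-sound S valid (close closes)    v       eq = closes-sound S (valid ≤-refl) closes v eq
check-sound S valid (branch checkᵃ _) (a ∷ v) eq =
  read-sound a S (check-sound _ (valid ∘ m≤n⇒m≤1+n) checkᵃ v (suc-injective eq))
check-sound S valid (branch _ checkᵇ) (b ∷ v) eq =
  read-sound b S (check-sound _ (valid ∘ m≤n⇒m≤1+n) checkᵇ v (suc-injective eq))

certificate-sound : ∀ {fuel r} → (∀ {r′} → r′ ≤ r → Valid r′) → Certificate fuel r → Valid (suc r)
certificate-sound {fuel} {r} valid = All.map (λ {H} → step H)
  where
  T = maxPals (suc r)
  step : ∀ H → Check fuel r T (read a H) × Check fuel r T (read b H) →
         ∀ v → length v ≡ suc r → Good T H v
  step H (checkᵃ , _) (a ∷ v) eq = read-sound a H (check-sound _ valid checkᵃ v (suc-injective eq))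
  step H (_ , checkᵇ) (b ∷ v) eq = read-sound b H (check-sound _ valid checkᵇ v (suc-injective eq))

-- Upper bound: shifting by six and the induction on length.

maxPals-+6 : ∀ {r} → 12 ≤ r → maxPals (6 + r) ≡ 2 + maxPals r
-- Once `r` has the form `12 + _`, the test for length 11 evaluates to `false` on both sides.
maxPals-+6 {r} 12≤r = subst (λ r → maxPals (6 + r) ≡ 2 + maxPals r) (m+[n∸m]≡n 12≤r)
  (formula-+6 (12 + (r ∸ 12)))

covers-+6 : ∀ {r T S H} → maxPals (6 + r) ≡ 2 + maxPals r →
            Covers r T S H → Covers (6 + r) (2 + T) S H
covers-+6 {r} {T} eq = All.map λ {(_ , c′)} → Any.map λ {(_ , c)} (s≡s′ , le) → s≡s′ , (begin
  c + maxPals (6 + r)     ≡⟨ cong (c +_) eq ⟩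
  c + (2 + maxPals r)     ≡⟨ +-suc² c (maxPals r) ⟩
  2 + (c + maxPals r)     ≤⟨ +-monoʳ-≤ 2 le ⟩
  2 + (c′ + T)            ≡⟨ +-suc² c′ T ⟨
  c′ + (2 + T)            ∎)
  where
  open ≤-Reasoning
  +-suc² : ∀ m n → m + (2 + n) ≡ 2 + (m + n)
  +-suc² m n = trans (+-suc m (suc n)) (cong suc (+-suc m n))

closes-+6 : ∀ {r T} S → 12 ≤ r → Closes r T S → Closes (6 + r) (2 + T) S
-- `states (6 + r)` evaluates to `states r`, so only the costs change.
closes-+6 {r} S 12≤r = Any.map (covers-+6 {r} (maxPals-+6 12≤r))

check-+6 : ∀ {fuel r T} S → fuel + 12 ≤ r → Check fuel r T S → Check fuel (6 + r) (2 + T) S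
check-+6 {fuel} S le (close closes) = close (closes-+6 S (≤-trans (m≤n+m 12 fuel) le) closes)
check-+6 S (s≤s le) (branch checkᵃ checkᵇ) = branch (check-+6 _ le checkᵃ) (check-+6 _ le checkᵇ)

-- With fuel 17 at least 12 letters remain at every leaf, so no leaf meets the exceptional length 11.
certificate-+6 : ∀ m → Certificate 17 (29 + m) → Certificate 17 (35 + m)
certificate-+6 m = All.map λ (checkᵃ , checkᵇ) → shift checkᵃ , shift checkᵇ
  where
  shift : ∀ {S} → Check 17 (29 + m) (maxPals (30 + m)) S → Check 17 (35 + m) (maxPals (36 + m)) S
  shift {S} check = subst (λ T → Check 17 (35 + m) T S) (sym (maxPals-+6 {30 + m} (m≤m+n 12 (18 + m))))
    (check-+6 S (m≤m+n 29 m) check)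

certificate-small : ∀ {r} → r < 29 → Certificate 29 r
-- Since `r < 29`, the letters run out before the fuel does.
certificate-small = from-yes (allUpTo? (certificate? 29) 29)

-- As 29 = 17 + 12, the shift by six applies from here on; one computation per residue class starts
-- it.
certificate-large : ∀ m → Certificate 17 (29 + m)
certificate-large 0 = from-yes (certificate? 17 29)
certificate-large 1 = from-yes (certificate? 17 30)
certificate-large 2 = from-yes (certificate? 17 31)
certificate-large 3 = from-yes (certificate? 17 32)
certificate-large 4 = from-yes (certificate? 17 33)
certificate-large 5 = from-yes (certificate? 17 34)
certificate-large (suc (suc (suc (suc (suc (suc m)))))) =
  certificate-+6 m (certificate-large m)

valid-suc : ∀ r → (∀ {r′} → r′ ≤ r → Valid r′) → Valid (suc r)
valid-suc r ih with r <? 29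
... | yes r<29 = certificate-sound ih (certificate-small r<29)
... | no  r≮29 = certificate-sound ih
  (subst (Certificate 17) (m+[n∸m]≡n (≮⇒≥ r≮29)) (certificate-large (r ∸ 29)))

valid : ∀ r → Valid r
valid = <-rec Valid λ where
  zero    _   → (λ where [] _ → here (0 , pf-nil , z≤n)) ∷ []
  (suc r) rec → valid-suc r (λ r′≤r → rec (s≤s r′≤r))

factorisation : ∀ w → ∃[ j ] PalFact j w × j ≤ maxPals (length w)
factorisation w with here cheap ← All.head (valid (length w)) w refl = cheap

-- Lower bound: the local recursion on suffixes.

AtLeast : ℕ → Word → Set
AtLeast c w = ∀ j → PalFact j w → c ≤ j

-- Bounds for the successive suffixes of w, longest first, all relative to d.
data LowerBounds (d : ℕ) : List ℕ → Word → Set where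
  []  : ∀ {w} → LowerBounds d [] w
  _∷_ : ∀ {c cs w} → AtLeast (d + c) w → LowerBounds d cs (drop 1 w) → LowerBounds d (c ∷ cs) w

lowerBounds-take : ∀ {d cs cs′ w} n → take n cs ≡ cs′ → LowerBounds d cs w → LowerBounds d cs′ w
lowerBounds-take zero    refl _        = []
lowerBounds-take (suc n) refl []       = []
lowerBounds-take (suc n) refl (p ∷ ps) = p ∷ lowerBounds-take n refl ps

lowerBounds-map-+ : ∀ {d} e cs {w} → LowerBounds d (map (e +_) cs) w → LowerBounds (e + d) cs w
lowerBounds-map-+     e []       _              = []
lowerBounds-map-+ {d} e (c ∷ cs) {w} (p ∷ ps) =
  subst (λ x → AtLeast x w) (trans (sym (+-assoc d e c)) (cong (_+ c) (+-comm d e))) p ∷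
  lowerBounds-map-+ e cs ps

-- The bounds cs for the words left over when a palindromic prefix q ++ p is cut off,
-- for p a nonempty prefix of the second argument.
cutBounds : Word → Word → List ℕ → List ℕ
cutBounds q (x ∷ s) (c ∷ cs) =
  (if does (palindrome? (q ∷ʳ x)) then c ∷_ else λ rest → rest) (cutBounds (q ∷ʳ x) s cs)
cutBounds q _       _        = []

bound : Word → List ℕ → ℕ
bound w []       = 0
-- For nonempty `w` the default `c` is a genuine candidate: it belongs to cutting off a single
-- letter.
bound w (c ∷ cs) = suc (min c (cutBounds [] w (c ∷ cs)))

-- Keeps the evaluation of 'exactBounds' and 'bounds' linear: the argument is shared.
pushBound : Word → List ℕ → List ℕ
pushBound w cs = bound w cs ∷ cs

cutBounds-complete : ∀ {d j} q y p {s t u cs} → s ++ t ≡ (y ∷ p) ++ u → Palindrome (q ++ y ∷ p) →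
  length (y ∷ p) ≤ length s → length (y ∷ p) ≤ length cs →
  LowerBounds d cs (drop 1 (s ++ t)) → PalFact j u → Any (λ c → d + c ≤ j) (cutBounds q s cs)
cutBounds-complete q y [] {x ∷ s} {cs = c ∷ cs} refl pal _ _ (c≤ ∷ _) fact with palindrome? (q ∷ʳ x)
... | yes _ = here (c≤ _ fact)
... | no ¬pal = contradiction pal ¬pal
cutBounds-complete {d} {j} q y (z ∷ p) {x ∷ s} {cs = c ∷ cs} eq pal (s≤s ≤s) (s≤s ≤cs) (_ ∷ bs) fact
  with refl , eq′ ← ∷-injective eq
  with rec ← cutBounds-complete (q ∷ʳ x) z p {s} eq′ (subst Palindrome (sym (++-assoc q _ _)) pal)
               ≤s ≤cs bs fact
  with palindrome? (q ∷ʳ x)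
... | yes _ = there rec
... | no  _ = rec

Short : ℕ → Word → Set
Short k w = ∀ p {u} → w ≡ p ++ u → Palindrome p → length p ≤ k

-- The first palindrome of any factorisation has length at most `k`, so it lies within `x ∷ s` and
-- `cs` has a bound for what follows it; the tail `t` may be arbitrary.
bound-sound : ∀ {d k x s t} cs → Short k (x ∷ s ++ t) → k ≤ suc (length s) → k ≤ length cs →
  LowerBounds d cs (s ++ t) → AtLeast (d + bound (x ∷ s) cs) (x ∷ s ++ t)
bound-sound {d} {x = x} {s} {t} cs short k≤s k≤cs bs j fact = go cs k≤cs bs fact refl
  where
  go : ∀ cs → _ ≤ length cs → LowerBounds d cs (s ++ t) →
       ∀ {j w} → PalFact j w → x ∷ s ++ t ≡ w → d + bound (x ∷ s) cs ≤ j
  go cs k≤cs bs (pf-cons p u (y , p′ , refl) pal fact) eq with short p eq pal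
  go []       k≤cs bs (pf-cons p u (y , p′ , refl) pal fact) eq | ≤k with () ← ≤-trans ≤k k≤cs
  go (c ∷ cs) k≤cs bs (pf-cons {j} p u (y , p′ , refl) pal fact) eq | ≤k =
    subst (_≤ suc j) (sym (+-suc d _)) (s≤s (min-bound
      (cutBounds-complete [] y p′ {x ∷ s} eq pal (≤-trans ≤k k≤s) (≤-trans ≤k k≤cs) bs fact)))
    where
    min-bound : ∀ {xs} → Any (λ c → d + c ≤ j) xs → d + min c xs ≤ j
    min-bound {xs} any with z , z∈ , d+z≤j ← find any =
      ≤-trans (+-monoʳ-≤ d (min≤v⁺ c xs (inj₂ (lose z∈ ≤-refl)))) d+z≤j

exactBounds : Word → List ℕ
exactBounds []      = 0 ∷ []
exactBounds (x ∷ w) = pushBound (x ∷ w) (exactBounds w)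

length-exactBounds : ∀ w → length (exactBounds w) ≡ suc (length w)
length-exactBounds []      = refl
length-exactBounds (x ∷ w) = cong suc (length-exactBounds w)

short-length : ∀ w → Short (length w) w
short-length w p refl _ = length-++-≤ˡ p

exactBounds-sound : ∀ w → LowerBounds 0 (exactBounds w) w
exactBounds-sound w = subst (LowerBounds 0 (exactBounds w)) (++-identityʳ w) (go w)
  where
  go : ∀ w → LowerBounds 0 (exactBounds w) (w ++ [])
  go []      = (λ _ _ → z≤n) ∷ []
  go (x ∷ w) = bound-sound {s = w} {t = []} (exactBounds w) short ≤-refl
                 (≤-reflexive (sym (length-exactBounds w))) (go w) ∷ go w
    where
    short : Short (suc (length w)) (x ∷ w ++ [])
    short = subst (λ v → Short (length v) (x ∷ w ++ [])) (cong (x ∷_) (++-identityʳ w))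
              (short-length (x ∷ w ++ []))

-- Lower bound: short palindromic prefixes and prepended blocks.

palindrome-inner : ∀ x q y → Palindrome (x ∷ q ∷ʳ y) → Palindrome q
palindrome-inner x q y pal = ∷ʳ-injectiveˡ (reverse q) q (begin
  reverse q ∷ʳ x               ≡⟨ unfold-reverse x q ⟨
  reverse (x ∷ q)              ≡⟨ ∷-injectiveʳ (trans (sym (reverse-++ (x ∷ q) (y ∷ []))) pal) ⟩
  q ∷ʳ y                       ∎)
  where open ≡-Reasoning

short-∷ : ∀ {k w} x → Short k w → Short (2 + k) (x ∷ w)
short-∷ x short []      _  _ = z≤n
short-∷ x short (y ∷ p) eq pal with initLast p
... | []       = s≤s z≤n
... | q ∷ʳ′ z  = s≤s (begin
  length (q ∷ʳ z)    ≡⟨ trans (length-++ q) (+-comm (length q) 1) ⟩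
  suc (length q)     ≤⟨ s≤s (short q (trans (∷-injectiveʳ eq) (++-assoc q _ _)) (palindrome-inner y q z pal)) ⟩
  suc _              ∎)
  where open ≤-Reasoning

take-prefix : ∀ p {s t u : Word} → s ++ t ≡ p ++ u → length p ≤ length s → take (length p) s ≡ p
take-prefix []      _  _ = refl
take-prefix (y ∷ p) {x ∷ s} eq (s≤s le) with refl , eq′ ← ∷-injective eq =
  cong (x ∷_) (take-prefix p eq′ le)

-- Stripping its outer letters turns a palindromic prefix of x ∷ w into one of w, so only two new
-- lengths have to be excluded when a letter is prepended.
PalindromeFree : (k m : ℕ) → Word → Set
PalindromeFree k m s = ∀ {i} → i < suc m → k < i → ¬ Palindrome (take i s)

palindromeFree? : ∀ k m s → Dec (PalindromeFree k m s)
palindromeFree? k m s = allUpTo? (λ i → (k <? i) →-dec ¬? (palindrome? (take i s))) (suc m)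

short-tighten : ∀ {k m s t} → m ≤ length s → PalindromeFree k m s → Short m (s ++ t) → Short k (s ++ t)
short-tighten {k} m≤s free short p eq pal with k <? length p
... | no  k≮p = ≮⇒≥ k≮p
... | yes k<p = contradiction (subst Palindrome (sym (take-prefix p eq (≤-trans ≤m m≤s))) pal)
                              (free (s≤s ≤m) k<p)
  where ≤m = short p eq pal

bounds : Word → Word → List ℕ → List ℕ
bounds []      s cs = cs
bounds (x ∷ u) s cs = pushBound (x ∷ u ++ s) (bounds u s cs)

Fresh : Word → Word → Set
Fresh []      s = ⊤
Fresh (x ∷ u) s = PalindromeFree 5 7 (x ∷ u ++ s) × Fresh u s

fresh? : ∀ u s → Dec (Fresh u s)
fresh? []      s = yes tt
fresh? (x ∷ u) s = palindromeFree? 5 7 (x ∷ u ++ s) ×-dec fresh? u s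

Bounded : ℕ → List ℕ → Word → Set
Bounded d cs w = Short 5 w × LowerBounds d cs w

-- Six known letters and a new one cover the lengths 6 and 7 to be excluded, and five bounds reach
-- every cut. Values computed from `s` alone thus hold for every `t`.
bounded-++ : ∀ {d cs} u s t → 6 ≤ length s → 5 ≤ length cs → Fresh u s →
  Bounded d cs (s ++ t) → Bounded d (bounds u s cs) ((u ++ s) ++ t)
bounded-++ [] s t _ _ _ inv = inv
bounded-++ {d} {cs} (x ∷ u) s t 6≤s 5≤cs (free , fresh) inv
  with short , bs ← bounded-++ u s t 6≤s 5≤cs fresh inv
  = short′
  , bound-sound {s = u ++ s} (bounds u s cs) short′ (m≤n⇒m≤1+n (≤-trans (n≤1+n 5) 6≤us)) (5≤bounds u) bs ∷ bs
  where
  6≤us : 6 ≤ length (u ++ s)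
  6≤us = subst (6 ≤_) (sym (length-++ u)) (≤-trans 6≤s (m≤n+m _ (length u)))
  short′ : Short 5 (x ∷ (u ++ s) ++ t)
  short′ = short-tighten {s = x ∷ u ++ s} (s≤s 6≤us) free (short-∷ x short)
  5≤bounds : ∀ u → 5 ≤ length (bounds u s cs)
  5≤bounds []      = 5≤cs
  5≤bounds (x ∷ u) = m≤n⇒m≤1+n (5≤bounds u)

-- Lower bound: the extremal words.

period left right : Word
period = a ∷ a ∷ b ∷ a ∷ b ∷ b ∷ []
left   = a ∷ a ∷ b ∷ a ∷ b ∷ b ∷ b ∷ []
right  = a ∷ a ∷ a ∷ b ∷ a ∷ b ∷ b ∷ []

tailWord : ℕ → Word
tailWord zero    = right
tailWord (suc k) = period ++ tailWord k

length-tailWord : ∀ k → length (tailWord k) ≡ 7 + k * 6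
length-tailWord zero    = refl
length-tailWord (suc k) = cong (6 +_) (length-tailWord k)

-- With palindromes of length at most 5, five consecutive bounds determine all earlier ones. The six
-- entries of `leftBounds` are `formula` at 14, 13, ..., 9.
periodBounds leftBounds : List ℕ
periodBounds = 5 ∷ 5 ∷ 4 ∷ 4 ∷ 4 ∷ []
leftBounds   = 6 ∷ 5 ∷ 5 ∷ 4 ∷ 4 ∷ 4 ∷ []

short-base : Short 5 (period ++ right)
short-base = short-tighten {5} {13} {period ++ right} {[]} ≤-refl
  (from-yes (palindromeFree? 5 13 (period ++ right))) (short-length (period ++ right))

fresh-period : Fresh period period
fresh-period = from-yes (fresh? period period)

fresh-left : Fresh left period
fresh-left = from-yes (fresh? left period)

periodBounds-base : take 5 (exactBounds (period ++ right)) ≡ periodBounds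
periodBounds-base = refl

periodBounds-step : take 5 (bounds period period periodBounds) ≡ map (2 +_) periodBounds
periodBounds-step = refl

leftBounds-base : take 6 (exactBounds (left ++ right)) ≡ leftBounds
leftBounds-base = refl

leftBounds-step : take 6 (bounds left period periodBounds) ≡ map (2 +_) leftBounds
leftBounds-step = refl

bounded-tailWord : ∀ k → Bounded (k * 2) periodBounds (period ++ tailWord k)
bounded-tailWord zero    =
  short-base , lowerBounds-take 5 periodBounds-base (exactBounds-sound (period ++ right))
bounded-tailWord (suc k) = Product.map₂
  (λ bs → lowerBounds-map-+ 2 periodBounds (lowerBounds-take 5 periodBounds-step bs))
  (bounded-++ {k * 2} {periodBounds} period period (tailWord k) ≤-refl ≤-refl fresh-period (bounded-tailWord k))

leftBounds-sound : ∀ k → LowerBounds (k * 2) leftBounds (left ++ tailWord k)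
leftBounds-sound zero    = lowerBounds-take 6 leftBounds-base (exactBounds-sound (left ++ right))
leftBounds-sound (suc k) = lowerBounds-map-+ 2 leftBounds (lowerBounds-take 6 leftBounds-step
  (proj₂ (bounded-++ {k * 2} {periodBounds} left period (tailWord k) ≤-refl ≤-refl fresh-left (bounded-tailWord k))))

Attained : ℕ → ℕ → Set
Attained n K = ∃[ w ] length w ≡ n × AtLeast K w

attained-exact : ∀ w {c cs} → exactBounds w ≡ c ∷ cs → Attained (length w) c
attained-exact w eq with p ∷ _ ← lowerBounds-take 1 (cong (take 1) eq) (exactBounds-sound w) = w , refl , p

formula-+k*6 : ∀ k n → formula (k * 6 + n) ≡ k * 2 + formula n
formula-+k*6 zero    n = refl
formula-+k*6 (suc k) n = trans (formula-+6 (k * 6 + n)) (cong (2 +_) (formula-+k*6 k n))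

attained-family : ∀ k (r : Fin 6) → Attained (9 + (toℕ r + k * 6)) (k * 2 + formula (9 + toℕ r))
attained-family k r with leftBounds-sound k | cong suc (length-tailWord k)
... | b₀ ∷ b₁ ∷ b₂ ∷ b₃ ∷ b₄ ∷ b₅ ∷ [] | eq = go r
  where
  w = left ++ tailWord k
  go : ∀ r → Attained (9 + (toℕ r + k * 6)) (k * 2 + formula (9 + toℕ r))
  -- Of the 7 letters of `left`, `2 + r` are kept in front of the `7 + k * 6` letters of
  -- `tailWord k`.
  go 0F = drop 5 w , cong (1 +_) eq , b₅
  go 1F = drop 4 w , cong (2 +_) eq , b₄
  go 2F = drop 3 w , cong (3 +_) eq , b₃
  go 3F = drop 2 w , cong (4 +_) eq , b₂
  go 4F = drop 1 w , cong (5 +_) eq , b₁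
  go 5F = w        , cong (6 +_) eq , b₀

attained-≥9 : ∀ m → Attained (9 + m) (formula (9 + m))
attained-≥9 m with result k r eq ← m divMod 6 = subst₂ Attained (cong (9 +_) (sym eq)) (begin
  k * 2 + formula (9 + toℕ r)     ≡⟨ formula-+k*6 k (9 + toℕ r) ⟨
  formula (k * 6 + (9 + toℕ r))   ≡⟨ cong formula (+-comm (k * 6) (9 + toℕ r)) ⟩
  formula (9 + (toℕ r + k * 6))   ≡⟨ cong (λ m → formula (9 + m)) eq ⟨
  formula (9 + m)                 ∎) (attained-family k r)
  where open ≡-Reasoning

attained : ∀ n → Attained (suc n) (formula (suc n))
attained 0 = attained-exact (a ∷ []) refl
attained 1 = attained-exact (a ∷ b ∷ []) refl
attained 2 = attained-exact (drop 4 right) refl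
attained 3 = attained-exact (drop 3 right) refl
attained 4 = attained-exact (drop 2 right) refl
attained 5 = attained-exact (drop 1 right) refl
attained 6 = attained-exact right refl
attained 7 = attained-exact (take 8 (period ++ period)) refl
attained (suc (suc (suc (suc (suc (suc (suc (suc m)))))))) = attained-≥9 m

attained-11 : Attained 11 5
attained-11 = attained-exact (take 11 (period ++ period)) refl

-- Combining the two bounds.

isK : ∀ {n K} → maxPals n ≡ K → Attained n K → IsK n K
isK {n} {K} refl (w , refl , atLeast) = (w , refl , fact-K , atLeast) , upper
  where
  fact-K : PalFact K w
  fact-K with j , fact , j≤K ← factorisation w =
    subst (λ k → PalFact k w) (≤-antisym j≤K (atLeast j fact)) fact
  upper : ∀ w′ k → length w′ ≡ length w → IsM w′ k → k ≤ maxPals (length w)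
  upper w′ k eq (_ , least) with j , fact , j≤ ← factorisation w′ =
    ≤-trans (least j fact) (subst (λ n → j ≤ maxPals n) eq j≤)

maxPals≡formula : ∀ n → suc n ≢ 11 → maxPals (suc n) ≡ formula (suc n)
maxPals≡formula n n≢ with n ≡ᵇ 10 in eq
... | false = refl
... | true  = contradiction (cong suc (≡ᵇ⇒≡ n 10 (subst Bool.T (sym eq) tt))) n≢

theorem1 : (∀ n → suc n ≢ 11 → IsK (suc n) (suc n / 6 + (suc n + 4) / 6 + 1))
    × IsK 11 5
theorem1 = (λ n n≢ → isK (maxPals≡formula n n≢) (attained n)) , isK refl attained-11
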